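{- Let $n$ be a positive integer and let $A(n)=(a_{ij})$, $p=p(n)$, $pp=pp(n)$, $b(n)$ be as in the context. Let $m\ge 1$ be an integer such that $\overline{p}=pm$ satisfies $\lfloor \overline{p}/2\rfloor> b(n)$, put $r=\lfloor\overline{p}/2\rfloor$, let $v$ be an integer with $v\ge pp+\overline{p}$, and let $B=(b_{ij})_{1\le i,j\le\overline{p}}$ be the $\overline{p}\times\overline{p}$ matrix with $b_{ij}=a_{v+i,v+j}$ if $i-r\le j\le i+r$; $b_{ij}=a_{v+i,v+j-\overline{p}}$ if $j>i+r$; $b_{ij}=a_{v+i,v+j+\overline{p}}$ if $j<i-r$. Then every column of $B$ contains exactly $n+1$ ones.
   Context: $\mathbb{N}=\{1,2,3,\dots\}$. Fix a positive integer $n$. The infinite $\{0,1\}$-matrix $A(n)=(a_{ij})_{i,j\in\mathbb{N}}$ is defined recursively. Its entries are determined row by row (row $1$ first), and within each row from left to right, so that $a_{kl}$ is determined after all $a_{ij}$ with $i<k$ and all $a_{kj}$ with $j<l$. One sets $a_{kl}=1$ if and only if all of the following hold: (1) $\sum_{j<l}a_{kj}<n+1$; (2) $\sum_{i<k}a_{il}<n+1$; (3) there is no pair $(i,j)$ with $1\le i<k$, $1\le j<l$ and $a_{ij}=a_{il}=a_{kj}=1$. Otherwise $a_{kl}=0$. The matrix $A(n)$ is eventually periodic along the diagonal: there exist $c\ge0$, $q\ge1$ with $a_{i+q,j+q}=a_{ij}$ for all $i>c$, $j\ge1$. The period $p=p(n)$ is the smallest $q\ge1$ for which such a $c$ exists,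 and the preperiod $pp=pp(n)$ is the smallest $c\ge 0$ with $a_{i+p,j+p}=a_{ij}$ for all $i>c$, $j\ge 1$. Define $b(n)=\max\{|j-i| : i,j\ge1,\ a_{ij}=1,\ i>pp(n)\}$. -}

module Defs where

open import Data.Bool using (Bool; true; false; _∧_; _∨_; not; if_then_else_; T?)
open import Data.Fin using (Fin; toℕ)
open import Data.Nat using (ℕ; zero; suc; _+_; _∸_; _≤_; _<_; _≤ᵇ_; _<ᵇ_; ∣_-_∣; ⌊_/2⌋)
open import Data.Product using (_×_; ∃; ∃₂)
open import Data.Vec using (tabulate; count)
open import Relation.Binary.PropositionalEquality using (_≡_)

-- The {0,1}-matrix A(n), with true standing for 1.  Indices are the 1-based
-- ones of the mathematics; row 0 and column 0 are padding filled with false.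

mutual
  a : (n k l : ℕ) → Bool
  a n zero    l       = false
  a n (suc k) zero    = false
  a n (suc k) (suc l) =
    (rowOnes n (suc k) l <ᵇ n + 1) ∧
    (colOnes n k (suc l) <ᵇ n + 1) ∧
    not (anyRow n (suc k) (suc l) k l)

  -- Σ_{1 ≤ j ≤ t} a_{kj}
  rowOnes : (n k t : ℕ) → ℕ
  rowOnes n k zero    = 0
  rowOnes n k (suc t) = rowOnes n k t + (if a n k (suc t) then 1 else 0)

  -- Σ_{1 ≤ i ≤ s} a_{il}
  colOnes : (n s l : ℕ) → ℕ
  colOnes n zero    l = 0
  colOnes n (suc s) l = colOnes n s l + (if a n (suc s) l then 1 else 0)

  -- Some 1 ≤ i ≤ s and 1 ≤ j ≤ t have a_{ij} = a_{il} = a_{kj} = 1.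
  anyRow : (n k l s t : ℕ) → Bool
  anyRow n k l zero    t = false
  anyRow n k l (suc s) t = anyRow n k l s t ∨ anyCol n k l (suc s) t

  -- Some 1 ≤ j ≤ t has a_{ij} = a_{il} = a_{kj} = 1.
  anyCol : (n k l i t : ℕ) → Bool
  anyCol n k l i zero    = false
  anyCol n k l i (suc t) =
    anyCol n k l i t ∨ (a n i (suc t) ∧ a n i l ∧ a n k (suc t))

IsLeast : (ℕ → Set) → ℕ → Set
IsLeast P x = P x × (∀ y → P y → x ≤ y)

IsGreatest : (ℕ → Set) → ℕ → Set
IsGreatest P x = P x × (∀ y → P y → y ≤ x)

PeriodicAfter : (n q c : ℕ) → Set
PeriodicAfter n q c = ∀ i j → c < i → 1 ≤ j → a n (i + q) (j + q) ≡ a n i j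

-- p = p(n)
IsPeriod : (n p : ℕ) → Set
IsPeriod n = IsLeast (λ q → 1 ≤ q × ∃ (PeriodicAfter n q))

-- pp = pp(n), given p = p(n)
IsPreperiod : (n p pp : ℕ) → Set
IsPreperiod n p = IsLeast (PeriodicAfter n p)

-- b = b(n), given pp = pp(n)
IsBandwidth : (n pp b : ℕ) → Set
IsBandwidth n pp = IsGreatest λ d →
  ∃₂ λ i j → 1 ≤ i × 1 ≤ j × a n i j ≡ true × pp < i × d ≡ ∣ j - i ∣

-- b_{ij} in terms of 1-based i and j.  The inequality i - r ≤ j is written
-- i ≤ j + r, and the last branch is the remaining case j < i - r.  The
-- subtraction does not truncate when v ≥ p̄.
entryB : (n p̄ v i j : ℕ) → Bool
entryB n p̄ v i j =
  if (i ≤ᵇ j + r) ∧ (j ≤ᵇ i + r) then a n (v + i) (v + j)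
  else if i + r <ᵇ j             then a n (v + i) (v + j ∸ p̄)
  else                                a n (v + i) (v + j + p̄)
  where
  r = ⌊ p̄ /2⌋

-- A 0-based position in Fin p̄ stands for the 1-based index one larger.
B : (n p̄ v : ℕ) → Fin p̄ → Fin p̄ → Bool
B n p̄ v i j = entryB n p̄ v (suc (toℕ i)) (suc (toℕ j))

onesInColumn : ∀ {s t} → (Fin s → Fin t → Bool) → Fin t → ℕ
onesInColumn M j = count T? (tabulate (λ i → M i j))

{-# OPTIONS --safe #-}

-- Row k of A(n) contains exactly n + 1 ones: once the finitely many earlier rows
-- have run out of ones, only the bound on the row itself can prevent a one.
-- Row i of B is row v + i of A(n) folded modulo p̄, and the bandwidth hypothesis
-- makes the folding lose nothing, so every row of B has at least n + 1 ones.
-- By periodicity the entries of column j of B are entries of column v + j of A(n)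
-- in distinct rows, so every column of B has at most n + 1 ones.  As B is square,
-- double counting gives equality.

module Submission where

open import Data.Bool using (Bool; true; false; _∧_; if_then_else_; T; T?)
open import Data.Bool.Properties using (T-≡; ∧-zeroʳ; ¬-not)
open import Data.Empty using (⊥-elim)
open import Data.Fin using (Fin; toℕ)
open import Data.Fin.Properties using (toℕ<n)
open import Data.Nat using (ℕ; zero; suc; _+_; _∸_; _*_; _≤_; _<_; _≥_; _>_; _≤ᵇ_; _<ᵇ_; z≤n; s≤s; ⌊_/2⌋)
open import Data.Nat.Properties
open import Data.Nat.Tactic.RingSolver using (solve-∀)
open import Data.Product using (_,_; proj₂)
open import Data.Vec using (tabulate; count)
open import Function using (_∘_; Equivalence)
open import Relation.Binary.PropositionalEquality using (_≡_; refl; sym; trans; cong; cong₂; subst; subst₂; module ≡-Reasoning)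
open import Relation.Nullary using (yes; no)
open import Defs

-- Finite sums

Σ₁ : (ℕ → ℕ) → ℕ → ℕ
Σ₁ f zero    = 0
Σ₁ f (suc N) = Σ₁ f N + f (suc N)

Σ₁-mono-≤ : ∀ {f g} → (∀ x → f (suc x) ≤ g (suc x)) → ∀ N → Σ₁ f N ≤ Σ₁ g N
Σ₁-mono-≤ f≤g zero    = z≤n
Σ₁-mono-≤ f≤g (suc N) = +-mono-≤ (Σ₁-mono-≤ f≤g N) (f≤g N)

Σ₁-vanish : ∀ {f} N → (∀ x → x ≤ N → f x ≡ 0) → Σ₁ f N ≡ 0
Σ₁-vanish zero    f≡0 = refl
Σ₁-vanish (suc N) f≡0 =
  cong₂ _+_ (Σ₁-vanish N (λ x x≤N → f≡0 x (m≤n⇒m≤1+n x≤N))) (f≡0 (suc N) ≤-refl)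

Σ₁-zero : ∀ N → Σ₁ (λ _ → 0) N ≡ 0
Σ₁-zero N = Σ₁-vanish N (λ _ _ → refl)

Σ₁-split : ∀ f M N → Σ₁ f (M + N) ≡ Σ₁ f M + Σ₁ (λ x → f (M + x)) N
Σ₁-split f M zero    = trans (cong (Σ₁ f) (+-identityʳ M)) (sym (+-identityʳ _))
Σ₁-split f M (suc N) rewrite +-suc M N | Σ₁-split f M N =
  +-assoc (Σ₁ f M) (Σ₁ (λ x → f (M + x)) N) (f (suc (M + N)))

+-interchange : ∀ x y z w → (x + y) + (z + w) ≡ (x + z) + (y + w)
+-interchange = solve-∀

Σ₁-distrib-+ : ∀ f g N → Σ₁ (λ x → f x + g x) N ≡ Σ₁ f N + Σ₁ g N
Σ₁-distrib-+ f g zero    = refl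
Σ₁-distrib-+ f g (suc N) rewrite Σ₁-distrib-+ f g N =
  +-interchange (Σ₁ f N) (Σ₁ g N) (f (suc N)) (g (suc N))

Σ₁-swap : ∀ (f : ℕ → ℕ → ℕ) M N →
  Σ₁ (λ x → Σ₁ (λ y → f x y) N) M ≡ Σ₁ (λ y → Σ₁ (λ x → f x y) M) N
Σ₁-swap f zero    N = sym (Σ₁-zero N)
Σ₁-swap f (suc M) N rewrite Σ₁-swap f M N =
  sym (Σ₁-distrib-+ (λ y → Σ₁ (λ x → f x y) M) (f (suc M)) N)

*≤Σ₁ : ∀ {f} c N → (∀ x → x < N → c ≤ f (suc x)) → N * c ≤ Σ₁ f N
*≤Σ₁ c zero    c≤f = z≤n
*≤Σ₁ {f} c (suc N) c≤f = subst (_≤ Σ₁ f (suc N)) (+-comm (N * c) c)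
  (+-mono-≤ (*≤Σ₁ c N (λ x x<N → c≤f x (m<n⇒m<1+n x<N))) (c≤f N ≤-refl))

Σ₁≤* : ∀ {f} c N → (∀ x → f (suc x) ≤ c) → Σ₁ f N ≤ N * c
Σ₁≤* c zero    f≤c = z≤n
Σ₁≤* {f} c (suc N) f≤c = subst (Σ₁ f (suc N) ≤_) (+-comm (N * c) c)
  (+-mono-≤ (Σ₁≤* c N f≤c) (f≤c N))

-- A total that reaches its maximum leaves no slack in any term. Bounding the other terms by `N * c`
-- forces the last one up to `c`; bounding the last one by `c` passes the hypothesis on to the first
-- `N`.
saturated : ∀ {f} c N → (∀ x → f (suc x) ≤ c) → N * c ≤ Σ₁ f N →
  ∀ x → x < N → f (suc x) ≡ c
saturated {f} c (suc N) f≤c Nc≤Σ x x<1+N with x ≟ N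
... | yes refl = ≤-antisym (f≤c N) (+-cancelˡ-≤ (N * c) _ _
  (≤-trans (≤-reflexive (+-comm (N * c) c))
    (≤-trans Nc≤Σ (+-monoˡ-≤ (f (suc N)) (Σ₁≤* c N f≤c)))))
... | no x≢N   = saturated c N f≤c
  (+-cancelʳ-≤ c _ _ (≤-trans (≤-reflexive (+-comm (N * c) c))
    (≤-trans Nc≤Σ (+-monoʳ-≤ (Σ₁ f N) (f≤c N)))))
  x (≤∧≢⇒< (≤-pred x<1+N) x≢N)

-- The windows of length `q` starting after `w`, `w + q` and `w + q + q` are superimposed modulo
-- `q`. Three suffice because `B` reads from the middle one or from a neighbour.
fold₃ : (ℕ → ℕ) → (w q : ℕ) → ℕ → ℕ
fold₃ f w q x = f (w + x) + f (w + q + x) + f (w + q + q + x)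

Σ₁-fold₃ : ∀ f w q → Σ₁ f (w + q + q + q) ≡ Σ₁ f w + Σ₁ (fold₃ f w q) q
Σ₁-fold₃ f w q = begin
  Σ₁ f (w + q + q + q)            ≡⟨ Σ₁-split f (w + q + q) q ⟩
  Σ₁ f (w + q + q) + Σ₁ f₂ q      ≡⟨ cong (_+ Σ₁ f₂ q) (Σ₁-split f (w + q) q) ⟩
  Σ₁ f (w + q) + Σ₁ f₁ q + Σ₁ f₂ q
    ≡⟨ cong (λ s → s + Σ₁ f₁ q + Σ₁ f₂ q) (Σ₁-split f w q) ⟩
  Σ₁ f w + Σ₁ f₀ q + Σ₁ f₁ q + Σ₁ f₂ q
    ≡⟨ regroup (Σ₁ f w) (Σ₁ f₀ q) (Σ₁ f₁ q) (Σ₁ f₂ q) ⟩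
  Σ₁ f w + (Σ₁ f₀ q + Σ₁ f₁ q + Σ₁ f₂ q)
    ≡⟨ cong (λ s → Σ₁ f w + (s + Σ₁ f₂ q)) (Σ₁-distrib-+ f₀ f₁ q) ⟨
  Σ₁ f w + (Σ₁ (λ x → f₀ x + f₁ x) q + Σ₁ f₂ q)
    ≡⟨ cong (Σ₁ f w +_) (Σ₁-distrib-+ (λ x → f₀ x + f₁ x) f₂ q) ⟨
  Σ₁ f w + Σ₁ (fold₃ f w q) q     ∎
  where
  open ≡-Reasoning
  f₀ f₁ f₂ : ℕ → ℕ
  f₀ x = f (w + x)
  f₁ x = f (w + q + x)
  f₂ x = f (w + q + q + x)
  regroup : ∀ x y z u → x + y + z + u ≡ x + (y + z + u)
  regroup = solve-∀

χ : Bool → ℕ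
χ x = if x then 1 else 0

count-tabulate : ∀ (f : ℕ → Bool) N →
  count T? (tabulate {n = N} (λ i → f (suc (toℕ i)))) ≡ Σ₁ (χ ∘ f) N
count-tabulate f zero    = refl
count-tabulate f (suc N) rewrite Σ₁-split (χ ∘ f) 1 N with f 1
... | true  = cong suc (count-tabulate (f ∘ suc) N)
... | false = count-tabulate (f ∘ suc) N

-- Row and column counts of A(n)

rowOnes≡Σ₁ : ∀ n k t → rowOnes n k t ≡ Σ₁ (λ j → χ (a n k j)) t
rowOnes≡Σ₁ n k zero    = refl
rowOnes≡Σ₁ n k (suc t) = cong (_+ χ (a n k (suc t))) (rowOnes≡Σ₁ n k t)

colOnes≡Σ₁ : ∀ n s l → colOnes n s l ≡ Σ₁ (λ i → χ (a n i l)) s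
colOnes≡Σ₁ n zero    l = refl
colOnes≡Σ₁ n (suc s) l = cong (_+ χ (a n (suc s) l)) (colOnes≡Σ₁ n s l)

<ᵇ-true : ∀ {x y} → x < y → (x <ᵇ y) ≡ true
<ᵇ-true x<y = Equivalence.to T-≡ (<⇒<ᵇ x<y)

∧-trueˡ : ∀ x {y} → x ∧ y ≡ true → x ≡ true
∧-trueˡ true _ = refl

∧-trueʳ : ∀ x {y} → x ∧ y ≡ true → y ≡ true
∧-trueʳ true eq = eq

a-true⇒rowOnes< : ∀ n k t → a n k (suc t) ≡ true → rowOnes n k t < n + 1
a-true⇒rowOnes< n (suc k) t eq = <ᵇ⇒< _ _ (Equivalence.from T-≡ (∧-trueˡ _ eq))

a-true⇒colOnes< : ∀ n s l → a n (suc s) l ≡ true → colOnes n s l < n + 1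
a-true⇒colOnes< n s (suc l) eq =
  <ᵇ⇒< _ _ (Equivalence.from T-≡ (∧-trueˡ _ (∧-trueʳ (rowOnes n (suc s) l <ᵇ n + 1) eq)))

rowOnes≤ : ∀ n k t → rowOnes n k t ≤ n + 1
rowOnes≤ n k zero = z≤n
rowOnes≤ n k (suc t) with a n k (suc t) in eq
... | true  = subst (_≤ n + 1) (+-comm 1 _) (a-true⇒rowOnes< n k t eq)
... | false = subst (_≤ n + 1) (sym (+-identityʳ _)) (rowOnes≤ n k t)

colOnes≤ : ∀ n s l → colOnes n s l ≤ n + 1
colOnes≤ n zero l = z≤n
colOnes≤ n (suc s) l with a n (suc s) l in eq
... | true  = subst (_≤ n + 1) (+-comm 1 _) (a-true⇒colOnes< n s l eq)
... | false = subst (_≤ n + 1) (sym (+-identityʳ _)) (colOnes≤ n s l)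

-- Every row of A(n) fills up

colOnes-vanish : ∀ n s l → (∀ i → i ≤ s → a n i l ≡ false) → colOnes n s l ≡ 0
colOnes-vanish n s l empty =
  trans (colOnes≡Σ₁ n s l) (Σ₁-vanish s (λ i i≤s → cong χ (empty i i≤s)))

anyCol-vanish : ∀ n k l i t → a n i l ≡ false → anyCol n k l i t ≡ false
anyCol-vanish n k l i zero    eq = refl
anyCol-vanish n k l i (suc t) eq rewrite anyCol-vanish n k l i t eq | eq = ∧-zeroʳ _

anyRow-vanish : ∀ n k l s t → (∀ i → i ≤ s → a n i l ≡ false) → anyRow n k l s t ≡ false
anyRow-vanish n k l zero    t empty = refl
anyRow-vanish n k l (suc s) t empty
  rewrite anyRow-vanish n k l s t (λ i i≤s → empty i (m≤n⇒m≤1+n i≤s)) =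
  anyCol-vanish n k l (suc s) t (empty (suc s) ≤-refl)

-- An empty column above the entry gives column sum 0 and no `i` with `a_{il} = 1`, so conditions
-- (2) and (3) hold and only the row bound remains.
a-greedy : ∀ n k l → (∀ i → i ≤ k → a n i (suc l) ≡ false) →
  rowOnes n (suc k) l < n + 1 → a n (suc k) (suc l) ≡ true
a-greedy n k l empty row<
  rewrite <ᵇ-true row< | colOnes-vanish n k (suc l) empty
        | anyRow-vanish n (suc k) (suc l) k l empty
        | <ᵇ-true {0} {n + 1} (m≤n+m 1 n) = refl

-- To the right of `L` all earlier rows are empty, so `a-greedy` places a one in each further column
-- until the row is full.
rowOnes-grow : ∀ n k L → (∀ i l → i ≤ k → L < l → a n i l ≡ false) →
  ∀ d → d ≤ n + 1 → d ≤ rowOnes n (suc k) (L + d)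
rowOnes-grow n k L empty zero    _ = z≤n
rowOnes-grow n k L empty (suc d) d<n+1
  rewrite +-suc L d with rowOnes n (suc k) (L + d) <? n + 1
... | yes row<
  rewrite a-greedy n k (L + d) (λ i i≤k → empty i _ i≤k (s≤s (m≤m+n L d))) row< =
  subst (_≤ rowOnes n (suc k) (L + d) + 1) (+-comm d 1)
    (+-monoˡ-≤ 1 (rowOnes-grow n k L empty d (<⇒≤ d<n+1)))
... | no row≮ = ≤-trans d<n+1 (≤-trans (≮⇒≥ row≮) (m≤m+n _ _))

rowOnes-mono : ∀ n k {s t} → s ≤ t → rowOnes n k s ≤ rowOnes n k t
rowOnes-mono n k {s} {t} s≤t with m≤n⇒∃[o]m+o≡n s≤t
... | d , refl = subst₂ _≤_ (sym (rowOnes≡Σ₁ n k s))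
  (trans (sym (Σ₁-split _ s d)) (sym (rowOnes≡Σ₁ n k (s + d)))) (m≤m+n _ _)

full⇒false : ∀ n k l {L} → L < l → n + 1 ≤ rowOnes n k L → a n k l ≡ false
full⇒false n k (suc l) (s≤s L≤l) full = ¬-not λ eq →
  <⇒≱ (a-true⇒rowOnes< n k l eq) (≤-trans full (rowOnes-mono n k L≤l))

mutual
  -- Joint induction on `k`: if the first `k` rows end by column `k * (n + 1)`, the next row fills
  -- within `n + 1` further columns, and a full row receives no more ones.
  rows-vanish : ∀ n k i l → i ≤ k → k * (n + 1) < l → a n i l ≡ false
  rows-vanish n k       zero    l _   _   = refl
  rows-vanish n (suc k) (suc i) l i≤k L<l with i ≟ k
  ... | yes refl = full⇒false n (suc k) l L<l (rowOnes-full n k)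
  ... | no i≢k   = rows-vanish n k (suc i) l (≤∧≢⇒< (≤-pred i≤k) i≢k)
    (≤-<-trans (m≤n+m (k * (n + 1)) (n + 1)) L<l)

  rowOnes-full : ∀ n k → n + 1 ≤ rowOnes n (suc k) (suc k * (n + 1))
  rowOnes-full n k = subst (λ t → n + 1 ≤ rowOnes n (suc k) t) (+-comm (k * (n + 1)) (n + 1))
    (rowOnes-grow n k (k * (n + 1)) (rows-vanish n k) (n + 1) ≤-refl)

rowOnes-full-from : ∀ n k t → 1 ≤ k → (∀ l → t < l → a n k l ≡ false) →
  n + 1 ≤ rowOnes n k t
rowOnes-full-from n (suc k) t _ empty = begin
  n + 1                                ≤⟨ rowOnes-full n k ⟩
  rowOnes n (suc k) L                  ≤⟨ rowOnes-mono n (suc k) (m≤n+m L t) ⟩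
  rowOnes n (suc k) (t + L)            ≡⟨ rowOnes≡Σ₁ n (suc k) (t + L) ⟩
  -- Column `t + L` is far enough for the row to be full, and the `L` columns after `t` contribute
  -- nothing.
  Σ₁ f (t + L)                         ≡⟨ Σ₁-split f t L ⟩
  Σ₁ f t + Σ₁ (λ x → f (t + x)) L      ≡⟨ cong (Σ₁ f t +_) (tail L) ⟩
  Σ₁ f t + 0                           ≡⟨ +-identityʳ _ ⟩
  Σ₁ f t                               ≡⟨ rowOnes≡Σ₁ n (suc k) t ⟨
  rowOnes n (suc k) t                  ∎
  where
  open ≤-Reasoning
  L = suc k * (n + 1)
  f : ℕ → ℕ
  f l = χ (a n (suc k) l)
  tail : ∀ N → Σ₁ (λ x → f (t + x)) N ≡ 0
  tail zero    = refl
  tail (suc N) = cong₂ _+_ (tail N) (cong χ (empty (t + suc N) (m<m+n t (s≤s z≤n))))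

-- The matrix B

periodic-* : ∀ {n p c} → PeriodicAfter n p c → ∀ m → PeriodicAfter n (p * m) c
periodic-* {n} {p} {c} per zero i j c<i 1≤j rewrite *-zeroʳ p | +-identityʳ i | +-identityʳ j = refl
periodic-* {n} {p} {c} per (suc m) i j c<i 1≤j
  rewrite *-suc p m | sym (+-assoc i p (p * m)) | sym (+-assoc j p (p * m)) =
  trans (periodic-* per m (i + p) (j + p) (<-≤-trans c<i (m≤m+n i p)) (≤-trans 1≤j (m≤m+n j p)))
        (per i j c<i 1≤j)

module Band {n pp b : ℕ} (band : IsBandwidth n pp b) where

  a-right : ∀ k l → pp < k → b + k < l → a n k l ≡ false
  a-right (suc k) (suc l) pp<k b+k<l = ¬-not λ eq →
    -- The truncated difference is already at least `suc b` and bounds the absolute difference from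
    -- below, which contradicts the maximality of `b`.
    <⇒≱ (m+n≤o⇒m≤o∸n (suc b) b+k<l)
      (≤-trans (m∸n≤∣m-n∣ (suc l) (suc k))
        (proj₂ band _ (suc k , suc l , s≤s z≤n , s≤s z≤n , eq , pp<k , refl)))

  a-left : ∀ k l → pp < k → b + l < k → a n k l ≡ false
  a-left (suc k) zero    _    _     = refl
  a-left (suc k) (suc l) pp<k b+l<k = ¬-not λ eq →
    <⇒≱ (m+n≤o⇒m≤o∸n (suc b) b+l<k)
      (≤-trans (m∸n≤∣m-n∣ (suc k) (suc l))
        (subst (_≤ b) (∣-∣-comm (suc l) (suc k))
          (proj₂ band _ (suc k , suc l , s≤s z≤n , s≤s z≤n , eq , pp<k , refl))))

-- Writing v = w + q removes the subtraction from the definition of B.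
data EntryB (n q w i j : ℕ) : Bool → Set where
  centre : i ≤ j + ⌊ q /2⌋ → j ≤ i + ⌊ q /2⌋ → EntryB n q w i j (a n (w + q + i) (w + q + j))
  right  : i + ⌊ q /2⌋ < j → EntryB n q w i j (a n (w + q + i) (w + j))
  left   : j + ⌊ q /2⌋ < i → EntryB n q w i j (a n (w + q + i) (w + q + q + j))

+-swapʳ : ∀ x y z → x + y + z ≡ x + z + y
+-swapʳ = solve-∀

entryB-view : ∀ n q w i j → EntryB n q w i j (entryB n q (w + q) i j)
entryB-view n q w i j = view
  where
  right′ : i + ⌊ q /2⌋ < j → EntryB n q w i j (a n (w + q + i) (w + q + j ∸ q))
  right′ lt = subst (EntryB n q w i j ∘ a n (w + q + i))
    (sym (trans (cong (_∸ q) (+-swapʳ w q j)) (m+n∸n≡m (w + j) q))) (right lt)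

  view : EntryB n q w i j (entryB n q (w + q) i j)
  view
    with i ≤ᵇ j + ⌊ q /2⌋ in e₁ | j ≤ᵇ i + ⌊ q /2⌋ in e₂ | i + ⌊ q /2⌋ <ᵇ j in e₃
  ... | true  | true  | _     = centre (≤ᵇ⇒≤ _ _ (Equivalence.from T-≡ e₁))
                                       (≤ᵇ⇒≤ _ _ (Equivalence.from T-≡ e₂))
  ... | true  | false | true  = right′ (<ᵇ⇒< _ _ (Equivalence.from T-≡ e₃))
  ... | false | _     | true  = right′ (<ᵇ⇒< _ _ (Equivalence.from T-≡ e₃))
  -- Impossible: the second and third tests are complementary, so they cannot both fail.
  ... | true  | false | false = ⊥-elim (subst T e₂
    (≤⇒≤ᵇ {j} {i + ⌊ q /2⌋} (≮⇒≥ λ lt → subst T e₃ (<⇒<ᵇ lt))))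
  ... | false | _     | false = subst (EntryB n q w i j)
    (cong (a n (w + q + i)) (+-swapʳ (w + q) q j))
    (left (≰⇒> λ le → subst T e₁ (≤⇒≤ᵇ le)))

-- Row and column sums of B

module Folding {n pp b q w : ℕ} (band : IsBandwidth n pp b) (per : PeriodicAfter n q pp)
               (b<r : b < ⌊ q /2⌋) (pp≤w : pp ≤ w) where

  open Band {n} {pp} {b} band

  r = ⌊ q /2⌋

  -- Since `b < r`, the sum is below twice the floor of `q / 2`, hence below `q`.
  b+r<q : b + r < q
  b+r<q = <-≤-trans (+-monoˡ-< r b<r)
    (≤-trans (+-monoʳ-≤ r (⌊n/2⌋≤⌈n/2⌉ q)) (≤-reflexive (⌊n/2⌋+⌈n/2⌉≡n q)))

  b<q : b < q
  b<q = ≤-<-trans (m≤m+n b r) b+r<q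

  pp<w+suc : ∀ i → pp < w + suc i
  pp<w+suc i = ≤-<-trans pp≤w (m<m+n w (s≤s z≤n))

  pp<row : ∀ i → pp < w + q + suc i
  pp<row i = ≤-<-trans (≤-trans pp≤w (m≤m+n w q)) (m<m+n (w + q) (s≤s z≤n))

  -- Strips the common offset `u` from a row and a column index, so that band conditions can be
  -- checked on relative positions.
  shift : ∀ u s {y z} → b + y < s + z → b + (u + y) < u + s + z
  shift u s {y} {z} lt = subst₂ _<_ (eq u b y) (sym (+-assoc u s z)) (+-monoʳ-< u lt)
    where
    eq : ∀ u x y → u + (x + y) ≡ x + (u + y)
    eq = solve-∀

  via-q : ∀ {x y} → x ≤ y + r → b + x < q + y
  via-q {x} {y} x≤y+r = ≤-<-trans (+-monoʳ-≤ b x≤y+r)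
    (subst (_< q + y) (eq b y r) (+-monoˡ-< y b+r<q))
    where
    eq : ∀ b y r → b + r + y ≡ b + (y + r)
    eq = solve-∀

  via-r : ∀ {x y} → x + r < y → b + x < y
  via-r {x} {y} lt = <-trans (+-monoˡ-< x b<r) (subst (_< y) (+-comm x r) lt)

  -- Of three columns congruent modulo `q`, at most one can meet the band in this row, and it is the
  -- one that `B` reads. `via-q` excludes the outer copies in the central case, `via-r` the copies
  -- beyond distance `r`.
  fold₃≤entryB : ∀ i j →
    fold₃ (λ l → χ (a n (w + q + suc i) l)) w q j ≤ χ (entryB n q (w + q) (suc i) j)
  fold₃≤entryB i j with entryB n q (w + q) (suc i) j | entryB-view n q w (suc i) j
  ... | _ | centre i≤ j≤
    rewrite a-left _ (w + j) (pp<row i) (shift w q (via-q j≤))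
          | a-right _ (w + q + q + j) (pp<row i) (shift (w + q) q (via-q i≤)) =
    ≤-reflexive (+-identityʳ _)
  ... | _ | right lt
    rewrite a-right _ (w + q + j) (pp<row i)
              (subst (b + (w + q + suc i) <_) (cong (_+ j) (+-identityʳ (w + q)))
                (shift (w + q) 0 (via-r lt)))
          | a-right _ (w + q + q + j) (pp<row i)
              (shift (w + q) q (≤-trans (via-r lt) (m≤n+m j q))) =
    ≤-reflexive (trans (+-identityʳ _) (+-identityʳ _))
  ... | _ | left lt
    rewrite a-left _ (w + q + j) (pp<row i)
              (subst (b + (w + q + j) <_) (cong (_+ suc i) (+-identityʳ (w + q)))
                (shift (w + q) 0 (via-r lt)))
          | a-left _ (w + j) (pp<row i)
              (shift w q (≤-trans (via-r lt) (m≤n+m (suc i) q))) = ≤-refl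

  rowB≥ : ∀ i → suc i ≤ q → n + 1 ≤ Σ₁ (λ j → χ (entryB n q (w + q) (suc i) j)) q
  rowB≥ i i<q = begin
    n + 1                           ≤⟨ full ⟩
    rowOnes n k (w + q + q + q)     ≡⟨ rowOnes≡Σ₁ n k (w + q + q + q) ⟩
    Σ₁ f (w + q + q + q)            ≡⟨ Σ₁-fold₃ f w q ⟩
    Σ₁ f w + Σ₁ (fold₃ f w q) q     ≡⟨ cong (_+ Σ₁ (fold₃ f w q) q) before ⟩
    Σ₁ (fold₃ f w q) q              ≤⟨ Σ₁-mono-≤ (λ j → fold₃≤entryB i (suc j)) q ⟩
    Σ₁ (λ j → χ (entryB n q (w + q) (suc i) j)) q ∎
    where
    open ≤-Reasoning
    k = w + q + suc i
    f : ℕ → ℕ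
    f l = χ (a n k l)
    -- Columns up to `w` are more than `q > b` to the left of row `k`. Likewise `k` is at most
    -- `w + q + q`, so columns past `w + q + q + q` lie to the right of the band.
    before : Σ₁ f w ≡ 0
    before = Σ₁-vanish w λ l l≤w → cong χ (a-left k l (pp<row i)
      (<-≤-trans (subst (b + l <_) (+-comm q w) (+-mono-<-≤ b<q l≤w)) (m≤m+n (w + q) (suc i))))
    after : ∀ l → w + q + q + q < l → a n k l ≡ false
    after l lt = a-right k l (pp<row i) (<-trans
      (subst (b + k <_) (+-comm q (w + q + q)) (+-mono-<-≤ b<q (+-monoʳ-≤ (w + q) i<q))) lt)
    full : n + 1 ≤ rowOnes n k (w + q + q + q)
    full = rowOnes-full-from n k (w + q + q + q) (≤-trans (s≤s z≤n) (m≤n+m (suc i) (w + q))) after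

  -- Periodicity moves every entry of column `j` of `B` into the single column `w + q + suc j` of
  -- A(n): a `right` entry goes down one window, a `left` entry up one. The row keeps its residue
  -- modulo `q`, so distinct `i` use distinct rows.
  entryB≤fold₃ : ∀ i j →
    χ (entryB n q (w + q) (suc i) (suc j)) ≤ fold₃ (λ k → χ (a n k (w + q + suc j))) w q (suc i)
  entryB≤fold₃ i j
    with entryB n q (w + q) (suc i) (suc j) | entryB-view n q w (suc i) (suc j)
  ... | _ | centre _ _ = ≤-trans (m≤n+m _ (χ (a n (w + suc i) (w + q + suc j)))) (m≤m+n _ _)
  ... | _ | right _ = ≤-trans (≤-reflexive (cong χ (sym eq))) (m≤n+m _ _)
    where
    eq : a n (w + q + q + suc i) (w + q + suc j) ≡ a n (w + q + suc i) (w + suc j)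
    eq = trans (cong₂ (a n) (+-swapʳ (w + q) q (suc i)) (+-swapʳ w q (suc j)))
      (per (w + q + suc i) (w + suc j) (pp<row i) (≤-trans (s≤s z≤n) (m≤n+m (suc j) w)))
  ... | _ | left _ = ≤-trans (≤-reflexive (cong χ eq)) (≤-trans (m≤m+n _ _) (m≤m+n _ _))
    where
    eq : a n (w + q + suc i) (w + q + q + suc j) ≡ a n (w + suc i) (w + q + suc j)
    eq = trans (cong₂ (a n) (+-swapʳ w q (suc i)) (+-swapʳ (w + q) q (suc j)))
      -- Moving up reaches row `w + suc i`, which lies beyond the preperiod because `pp ≤ w`.
      (per (w + suc i) (w + q + suc j) (pp<w+suc i) (≤-trans (s≤s z≤n) (m≤n+m (suc j) (w + q))))

  colB≤ : ∀ j → Σ₁ (λ i → χ (entryB n q (w + q) i (suc j))) q ≤ n + 1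
  colB≤ j = begin
    Σ₁ (λ i → χ (entryB n q (w + q) i (suc j))) q
                                    ≤⟨ Σ₁-mono-≤ (λ i → entryB≤fold₃ i j) q ⟩
    Σ₁ (fold₃ f w q) q              ≤⟨ m≤n+m _ (Σ₁ f w) ⟩
    Σ₁ f w + Σ₁ (fold₃ f w q) q     ≡⟨ Σ₁-fold₃ f w q ⟨
    Σ₁ f (w + q + q + q)            ≡⟨ colOnes≡Σ₁ n (w + q + q + q) l ⟨
    colOnes n (w + q + q + q) l     ≤⟨ colOnes≤ n (w + q + q + q) l ⟩
    n + 1                           ∎
    where
    open ≤-Reasoning
    l = w + q + suc j
    f : ℕ → ℕ
    f k = χ (a n k l)

  colB≡ : ∀ j → j < q → Σ₁ (λ i → χ (entryB n q (w + q) i (suc j))) q ≡ n + 1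
  -- Summing by rows gives at least `q * (n + 1)` ones; after exchanging the sums, the column bounds
  -- are saturated.
  colB≡ = saturated {λ j → Σ₁ (λ i → χ (entryB n q (w + q) i j)) q} (n + 1) q colB≤
    (≤-trans (*≤Σ₁ (n + 1) q rowB≥)
      (≤-reflexive (Σ₁-swap (λ i j → χ (entryB n q (w + q) i j)) q q)))

theorem4p3 : (n : ℕ) → n ≥ 1 →
    (p pp b : ℕ) → IsPeriod n p → IsPreperiod n p pp → IsBandwidth n pp b →
    (m : ℕ) → m ≥ 1 → ⌊ p * m /2⌋ > b →
    (v : ℕ) → v ≥ pp + p * m →
    (j : Fin (p * m)) → onesInColumn (B n (p * m) v) j ≡ n + 1
theorem4p3 n _ p pp b _ (per , _) band m _ b<r v v≥ j =
  -- Here `w` is `v ∸ q`; the bound on `v` gives both `w + q ≡ v` and `pp ≤ w`.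
  subst (λ u → onesInColumn (B n q u) j ≡ n + 1) (m∸n+n≡m (m+n≤o⇒n≤o pp v≥))
    (trans (count-tabulate (λ i → entryB n q (v ∸ q + q) i (suc (toℕ j))) q)
      (Folding.colB≡ band (periodic-* per m) b<r (m+n≤o⇒m≤o∸n pp v≥) (toℕ j) (toℕ<n j)))
  where q = p * m
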